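{- Let $P$ and $P'$ be two polymatroids on the same ground set $[n]$. If $P'\subset P$, then $I_{P'}\le I_P$ and $X_{P'}\le X_P$ coefficientwise.
   Context: A polymatroid on $[n]$ is $P=\{\mathbf a\in\mathbb{Z}^n\mid \sum_{i\in I}a_i\le f(I)\ \forall I\subset[n],\ \sum_{i\in[n]}a_i=f([n])\}$ with $f:2^{[n]}\to\mathbb{Z}$, $f(\emptyset)=0$, $f$ submodular. For $\mathbf a\in P$, $i$ is internally active if $\mathbf a-\mathbf e_i+\mathbf e_j\notin P$ for all $j<i$, externally active if $\mathbf a+\mathbf e_i-\mathbf e_j\notin P$ for all $j<i$; $\mathrm{Int}(\mathbf a),\mathrm{Ext}(\mathbf a)$ denote these sets. $I_P(x)=\sum_{\mathbf a\in P}x^{n-|\mathrm{Int}(\mathbf a)|}$, $X_P(y)=\sum_{\mathbf a\in P}y^{n-|\mathrm{Ext}(\mathbf a)|}$. For polynomials, $g_1\le g_2$ means every coefficient of $g_1$ is at most the corresponding coefficient of $g_2$. -}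

module Defs where

open import Data.Bool using (Bool; true; false)
open import Data.Nat as ℕ using (ℕ; zero; suc; _∸_)
open import Data.Integer as ℤ using (ℤ; +_; -[1+_]; _+_; _-_; 0ℤ; 1ℤ)
import Data.Integer.Properties as ℤP
open import Data.Fin as Fin using (Fin; toℕ)
import Data.Fin.Properties as FinP
open import Data.Fin.Subset using (Subset; inside; outside; ⊤; ⊥; ⁅_⁆; _∪_; _∩_) renaming (_-_ to _minus_)
open import Data.Vec as Vec using (Vec; []; _∷_; updateAt; lookup; tabulate)
open import Data.List as List using (List; []; _∷_; [_]; map; concatMap; upTo; filter; length)
open import Data.Product using (_×_; _,_; proj₁; proj₂)
open import Relation.Nullary using (Dec; yes; no; ¬_)
open import Relation.Nullary.Decidable using (_×-dec_; _→-dec_; ¬?; map′)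
open import Relation.Binary.PropositionalEquality using (_≡_)

IsPolymatroidRank : ∀ {n} → (Subset n → ℤ) → Set
IsPolymatroidRank {n} f =
  (f ⊥ ≡ 0ℤ) × (∀ (A B : Subset n) → f (A ∪ B) ℤ.+ f (A ∩ B) ℤ.≤ f A ℤ.+ f B)

sumOn : ∀ {n} → Subset n → Vec ℤ n → ℤ
sumOn []             []      = 0ℤ
sumOn (inside  ∷ I) (x ∷ a) = x + sumOn I a
sumOn (outside ∷ I) (x ∷ a) = sumOn I a

InP : ∀ {n} → (Subset n → ℤ) → Vec ℤ n → Set
InP {n} f a = (∀ (I : Subset n) → sumOn I a ℤ.≤ f I) × (sumOn ⊤ a ≡ f ⊤)

allSubsets? : ∀ n {P : Subset n → Set} → (∀ I → Dec (P I)) → Dec (∀ I → P I)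
allSubsets? zero    P? with P? []
... | yes p = yes (λ { [] → p })
... | no ¬p = no (λ h → ¬p (h []))
allSubsets? (suc n) {P} P?
  with allSubsets? n (λ I → P? (inside ∷ I)) | allSubsets? n (λ I → P? (outside ∷ I))
... | yes p | yes q = yes (λ { (true ∷ I) → p I ; (false ∷ I) → q I })
... | no ¬p | _     = no (λ h → ¬p (λ I → h (inside ∷ I)))
... | yes _ | no ¬q = no (λ h → ¬q (λ I → h (outside ∷ I)))

InP? : ∀ {n} (f : Subset n → ℤ) (a : Vec ℤ n) → Dec (InP f a)
InP? {n} f a = allSubsets? n (λ I → sumOn I a ℤ.≤? f I) ×-dec (sumOn ⊤ a ℤ.≟ f ⊤)

exch : ∀ {n} → Vec ℤ n → Fin n → Fin n → Vec ℤ n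
exch a i j = updateAt (updateAt a i (λ x → x - 1ℤ)) j (λ x → x + 1ℤ)

IntActive : ∀ {n} → (Subset n → ℤ) → Vec ℤ n → Fin n → Set
IntActive f a i = ∀ j → j Fin.< i → ¬ InP f (exch a i j)

ExtActive : ∀ {n} → (Subset n → ℤ) → Vec ℤ n → Fin n → Set
ExtActive f a i = ∀ j → j Fin.< i → ¬ InP f (exch a j i)

IntActive? : ∀ {n} f (a : Vec ℤ n) i → Dec (IntActive f a i)
IntActive? f a i = FinP.all? (λ j → (j FinP.<? i) →-dec ¬? (InP? f (exch a i j)))

ExtActive? : ∀ {n} f (a : Vec ℤ n) i → Dec (ExtActive f a i)
ExtActive? f a i = FinP.all? (λ j → (j FinP.<? i) →-dec ¬? (InP? f (exch a j i)))

#Int : ∀ {n} → (Subset n → ℤ) → Vec ℤ n → ℕ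
#Int {n} f a = length (filter (IntActive? f a) (List.allFin n))

#Ext : ∀ {n} → (Subset n → ℤ) → Vec ℤ n → ℕ
#Ext {n} f a = length (filter (ExtActive? f a) (List.allFin n))

-- Finite enumeration of P_f.
-- For a ∈ P_f:  a_i ≤ f({i})  and  a_i = f([n]) - Σ_{j≠i} a_j ≥ f([n]) - f([n]∖{i}),
-- so P_f lies in the box ∏_i [f([n]) - f([n]∖{i}), f({i})].  We list that box
-- and keep exactly the points of P_f.

rangeℤ : ℤ → ℤ → List ℤ
rangeℤ lo hi = go (hi - lo)
  where
  go : ℤ → List ℤ
  go (+ m)      = map (λ k → lo + + k) (upTo (suc m))
  go -[1+ _ ]   = []

box : ∀ {n} → Vec ℤ n → Vec ℤ n → List (Vec ℤ n)
box []       []       = [ [] ]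
box (l ∷ ls) (h ∷ hs) = concatMap (λ x → map (x ∷_) (box ls hs)) (rangeℤ l h)

lowerB upperB : ∀ {n} → (Subset n → ℤ) → Vec ℤ n
lowerB f = tabulate (λ i → f ⊤ - f (⊤ minus i))
upperB f = tabulate (λ i → f ⁅ i ⁆)

-- the lattice points of P_f, each listed exactly once
points : ∀ {n} → (Subset n → ℤ) → List (Vec ℤ n)
points f = filter (InP? f) (box (lowerB f) (upperB f))

-- Coefficients of the polynomials
--   I_P(x) = Σ_{a∈P} x^{n - |Int(a)|},   X_P(y) = Σ_{a∈P} y^{n - |Ext(a)|}.

coeffI : ∀ {n} → (Subset n → ℤ) → ℕ → ℕ
coeffI {n} f k = length (filter (λ a → (n ∸ #Int f a) ℕ.≟ k) (points f))

coeffX : ∀ {n} → (Subset n → ℤ) → ℕ → ℕ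
coeffX {n} f k = length (filter (λ a → (n ∸ #Ext f a) ℕ.≟ k) (points f))

{-# OPTIONS --safe #-}

-- Slice P by the value of its last coordinate. Activity of i < n is the same in P and in the
-- slice P_k = { a | (a , k) ∈ P }, and by the exchange property the last coordinate is active
-- exactly on the lowest nonempty slice P_m. Hence I_P = I_{P_m} + x Σ_{k > m} I_{P_k}.
-- Monotonicity follows by induction on n, proved together with a second inequality:
--   (B) if every a ∈ Q has some a + e_j ∈ R, then I_Q ≤ I_R + x I_Q.
-- (B) applies to adjacent slices P_{k+1} and P_k, so I_{P_k} ≤ I_{P_m} + x Σ_{m < i ≤ k} I_{P_i};
-- this handles a subpolymatroid whose lowest slice is above that of P.
-- The exterior polynomial of P is the interior polynomial of -P.
module Submission where

open import Defs
open import Data.Bool using (if_then_else_; true; false)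
import Data.Empty as Empty
open import Data.Fin as Fin using (Fin; inject₁; fromℕ)
import Data.Fin.Properties as FinP
open import Data.Fin.Relation.Unary.Top using (view; ‵fromℕ; ‵inject₁)
open import Data.Fin.Subset using (Subset; inside; outside; ⊤; ⊥; ∁; ⁅_⁆; _∪_; _∩_; _─_; _∈_; _∉_)
  renaming (_-_ to _minus_)
open import Data.Fin.Subset.Properties
  using (_∈?_; anySubset?; ∈⊤; ∉⊥; x∈p∪q⁻; x∈p∪q⁺; x∈∁p⇒x∉p; x∉p⇒x∈∁p; ∪-∩-booleanAlgebra)
import Algebra.Lattice.Properties.BooleanAlgebra as BooleanAlgebra
open import Algebra.Properties.AbelianGroup using (∙-cancelˡ)
open import Algebra.Properties.CommutativeSemigroup using (interchange)
open import Data.Integer as ℤ using (ℤ; _+_; _-_; -_; 0ℤ; 1ℤ; ∣_∣)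
import Data.Integer.Properties as ℤP
open import Data.Integer.Tactic.RingSolver using (solve-∀)
open import Data.List as List
  using (List; []; _∷_; _++_; map; filter; length; allFin; tabulate; concatMap; cartesianProductWith)
open import Data.List.Extrema.Nat using (max; xs≤max)
open import Data.List.Membership.Propositional using (lose; find) renaming (_∈_ to _∈ₗ_)
open import Data.List.Membership.Propositional.Properties
  using (∈-++⁺ˡ; ∈-++⁺ʳ; ∈-++⁻; ∈-map⁺; ∈-map⁻; ∈-upTo⁺; ∈-cartesianProductWith⁺; ∈-filter⁺; ∈-filter⁻; ∈-allFin)
open import Data.List.Membership.Propositional.Properties.WithK using (unique∧set⇒bag)
open import Data.List.Properties
  using (filter-++; filter-none; filter-≐; length-++; length-filter; length-map; length-tabulate)
open import Data.List.Relation.Binary.BagAndSetEquality using (∼bag⇒↭)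
open import Data.List.Relation.Binary.Permutation.Propositional.Properties using (↭-length)
import Data.List.Relation.Unary.All as All
open import Data.List.Relation.Unary.Any using (any?; here; there)
open import Data.List.Relation.Unary.Unique.Propositional using (Unique; []; _∷_)
import Data.List.Relation.Unary.Unique.Propositional.Properties as Unique
open import Data.Nat as ℕ using (ℕ; zero; suc; _∸_; _≤_; _<_; z≤n; s≤s)
import Data.Nat.Properties as ℕP
open import Data.Product using (∃; _×_; _,_; proj₁; proj₂)
open import Data.Sum using (inj₁; inj₂; [_,_]′)
open import Data.Vec as Vec using (Vec; []; _∷_; _∷ʳ_; updateAt; lookup; initLast; here; there)
open import Data.Vec.Properties
  using (∷-injective; ∷ʳ-injectiveˡ; ∷ʳ-injectiveʳ; lookup∘tabulate; map-updateAt; updateAt-commutes)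
open import Function using (_∘_; mk⇔)
open import Relation.Binary.PropositionalEquality
  using (_≡_; _≢_; refl; sym; trans; cong; cong₂; subst; subst₂; module ≡-Reasoning)
open import Relation.Nullary using (Dec; yes; no; ¬_; does; contradiction)
open import Relation.Nullary.Decidable using (_×-dec_; _→-dec_; ¬?; map′; dec-true; dec-false)
open import Relation.Unary using (Decidable)

private variable
  n : ℕ
  A B C : Set

-- Polynomials as coefficient sequences; shift is multiplication by x.
Poly : Set
Poly = ℕ → ℕ

infixl 6 _⊕_
infix 4 _≤ₚ_

_⊕_ : Poly → Poly → Poly
(p ⊕ q) d = p d ℕ.+ q d

shift : Poly → Poly
shift p zero    = 0
shift p (suc d) = p d

_≤ₚ_ : Poly → Poly → Set
p ≤ₚ q = ∀ d → p d ≤ q d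

shift-mono : ∀ {p q} → p ≤ₚ q → shift p ≤ₚ shift q
shift-mono p≤q zero    = z≤n
shift-mono p≤q (suc d) = p≤q d

shift-⊕ : ∀ p q d → shift (p ⊕ q) d ≡ shift p d ℕ.+ shift q d
shift-⊕ p q zero    = refl
shift-⊕ p q (suc d) = refl

-- Summing the polynomials of consecutive slices.

-- The facts about slices on which the estimates rest, detached from lattice points: `interval`
-- makes the nonempty slices consecutive, and `growth` is (B) for adjacent slices.
record SliceFamily : Set₁ where
  field
    poly       : ℕ → Poly
    Inhabited  : ℕ → Set
    inhabited? : ∀ k → Dec (Inhabited k)
    vanishes   : ∀ {k} → ¬ Inhabited k → ∀ d → poly k d ≡ 0
    interval   : ∀ {k m} → Inhabited (suc k) → Inhabited m → m ≤ k → Inhabited k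
    growth     : ∀ {k} → Inhabited (suc k) → Inhabited k →
                 poly (suc k) ≤ₚ poly k ⊕ shift (poly (suc k))

  -- By `interval`, a nonempty slice is the lowest one exactly when its immediate predecessor is
  -- empty, so lowestness is a test on a single neighbour.
  Preceded : ℕ → Set
  Preceded zero    = Empty.⊥
  Preceded (suc k) = Inhabited k

  preceded? : ∀ k → Dec (Preceded k)
  preceded? zero    = no λ ()
  preceded? (suc k) = inhabited? k

  -- Abstract, so that case splits on preceded? leave partial sums in goals intact.
  abstract
    contribution : ℕ → Poly
    contribution k = if does (preceded? k) then shift (poly k) else poly k

    contribution-preceded : ∀ {k} → Preceded k → contribution k ≡ shift (poly k)
    contribution-preceded {k} p rewrite dec-true (preceded? k) p = refl

    contribution-first : ∀ {k} → ¬ Preceded k → contribution k ≡ poly k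
    contribution-first {k} ¬p rewrite dec-false (preceded? k) ¬p = refl

    contribution-vanishes : ∀ {k} → ¬ Inhabited k → ∀ d → contribution k d ≡ 0
    contribution-vanishes {k} ¬i d with does (preceded? k) | d
    ... | false | d     = vanishes ¬i d
    ... | true  | zero  = refl
    ... | true  | suc d = vanishes ¬i d

  partialSum : ℕ → Poly
  partialSum zero    d = 0
  partialSum (suc k)   = partialSum k ⊕ contribution k

  empty-below : ∀ {k} → Inhabited k → ¬ Preceded k → ∀ {m} → m < k → ¬ Inhabited m
  empty-below {suc k} i ¬p (s≤s m≤k) j = ¬p (interval i j m≤k)

  partialSum-vanishes : ∀ k → (∀ {m} → m < k → ¬ Inhabited m) → ∀ d → partialSum k d ≡ 0
  partialSum-vanishes zero    empty d = refl
  partialSum-vanishes (suc k) empty d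
    rewrite partialSum-vanishes k (λ m<k → empty (ℕP.m<n⇒m<1+n m<k)) d
    = contribution-vanishes (empty (ℕP.n<1+n k)) d

  partialSum-first : ∀ {k} → Inhabited k → ¬ Preceded k → ∀ d → partialSum (suc k) d ≡ poly k d
  partialSum-first {k} i ¬p d =
    cong₂ ℕ._+_ (partialSum-vanishes k (empty-below i ¬p) d) (cong (λ c → c d) (contribution-first ¬p))

  partialSum-skip : ∀ {k} → ¬ Inhabited k → ∀ d → partialSum (suc k) d ≡ partialSum k d
  partialSum-skip {k} ¬i d rewrite contribution-vanishes ¬i d = ℕP.+-identityʳ _

  -- Iterating `growth` downwards leaves one shifted slice behind at each step, until the lowest
  -- nonempty slice takes up the rest unshifted.
  poly≤partialSum : ∀ k → poly k ≤ₚ partialSum (suc k)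
  poly≤partialSum zero    d = ℕP.≤-reflexive (cong (λ c → c d) (sym (contribution-first λ ())))
  poly≤partialSum (suc k) d with inhabited? k | inhabited? (suc k)
  ... | no ¬p  | _      = ℕP.≤-trans
      (ℕP.≤-reflexive (cong (λ c → c d) (sym (contribution-first ¬p)))) (ℕP.m≤n+m _ _)
  ... | yes _  | no ¬i  rewrite vanishes ¬i d = z≤n
  ... | yes p  | yes i  = ℕP.≤-trans (growth i p d)
      (ℕP.+-mono-≤ (poly≤partialSum k d)
        (ℕP.≤-reflexive (cong (λ c → c d) (sym (contribution-preceded p)))))

open SliceFamily

Preceded-mono : ∀ (P′ P : SliceFamily) →
  (∀ {k} → Inhabited P′ k → Inhabited P k) → ∀ k → Preceded P′ k → Preceded P k
Preceded-mono P′ P inh (suc k) = inh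

-- Above the lowest slice of `P′` both contributions are shifted and compare directly. At that
-- lowest slice the contribution of `P′` is unshifted while that of `P` may be shifted; but nothing
-- of `P′` has accumulated yet, so the whole partial sum of `P` is available and `poly≤partialSum`
-- suffices.
partialSum-mono : ∀ (P′ P : SliceFamily) →
  (∀ {k} → Inhabited P′ k → Inhabited P k) → (∀ k → poly P′ k ≤ₚ poly P k) →
  ∀ k → partialSum P′ k ≤ₚ partialSum P k
partialSum-mono P′ P inh le zero    d = z≤n
partialSum-mono P′ P inh le (suc k) d with inhabited? P′ k | preceded? P′ k
... | no ¬i | _ = ℕP.≤-trans
      (ℕP.≤-reflexive (partialSum-skip P′ ¬i d))
      (ℕP.≤-trans (partialSum-mono P′ P inh le k d) (ℕP.m≤m+n _ _))
... | yes i | no ¬p = ℕP.≤-trans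
      (ℕP.≤-reflexive (partialSum-first P′ i ¬p d))
      (ℕP.≤-trans (le k d) (poly≤partialSum P k d))
... | yes i | yes p = ℕP.+-mono-≤
      (partialSum-mono P′ P inh le k d)
      (subst₂ (λ c′ c → c′ d ≤ c d)
        (sym (contribution-preceded P′ p))
        (sym (contribution-preceded P (Preceded-mono P′ P inh k p)))
        (shift-mono (le k) d))

-- Inequality (B) for sums of slices.

-- The two outcomes when every point of `Q` can be raised into `R`: either slice `k` of `R` is
-- nonempty and (B) holds between the slices, or it is empty, the last coordinate is the one raised,
-- and slice `k` of `Q` embeds in slice `suc k` of `R`.
data Covers (Q R : SliceFamily) (k : ℕ) : Set where
  level : Inhabited R k → poly Q k ≤ₚ poly R k ⊕ shift (poly Q k) → Covers Q R k
  above : Inhabited R (suc k) → ¬ Inhabited R k → poly Q k ≤ₚ poly R (suc k) → Covers Q R k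

module _ (Q R : SliceFamily) (covers : ∀ {k} → Inhabited Q k → Covers Q R k) where

  -- The bottom slice of R may lie one step above that of Q;
  -- the partial sum of R then lags behind for exactly one step.
  data Progress (k : ℕ) : Set where
    settled : (Preceded Q k → Preceded R k) →
              partialSum Q k ≤ₚ partialSum R k ⊕ shift (partialSum Q k) → Progress k
    lagging : Preceded Q k → Inhabited R k → ¬ Preceded R k →
              partialSum Q k ≤ₚ poly R k → Progress k

  shift-poly≤shift-partialSum : ∀ k → shift (poly Q k) ≤ₚ shift (partialSum Q (suc k))
  shift-poly≤shift-partialSum k = shift-mono (poly≤partialSum Q k)

  partialSum-growing : ∀ k → shift (partialSum Q k) ≤ₚ shift (partialSum Q (suc k))
  partialSum-growing k = shift-mono {partialSum Q k} (λ d → ℕP.m≤m+n _ _)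

  progress-step : ∀ k → Progress k → Progress (suc k)
  progress-step k (settled prec le) with inhabited? Q k
  ... | no ¬i = settled (λ i → contradiction i ¬i) λ d → begin
      partialSum Q (suc k) d
        ≡⟨ partialSum-skip Q ¬i d ⟩
      partialSum Q k d
        ≤⟨ le d ⟩
      partialSum R k d ℕ.+ shift (partialSum Q k) d
        ≤⟨ ℕP.+-mono-≤ (ℕP.m≤m+n _ _) (partialSum-growing k d) ⟩
      partialSum R (suc k) d ℕ.+ shift (partialSum Q (suc k)) d ∎
    where open ℕP.≤-Reasoning
  ... | yes i with covers i | preceded? Q k
  -- Here `k` is preceded in both families, so both contributions carry the factor x: x times the
  -- covering inequality is added to the bound reached so far.
  ... | level iR le′ | yes p = settled (λ _ → iR) λ d → begin
      partialSum Q k d ℕ.+ contribution Q k d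
        ≡⟨ cong (λ c → partialSum Q k d ℕ.+ c d) (contribution-preceded Q p) ⟩
      partialSum Q k d ℕ.+ shift (poly Q k) d
        ≤⟨ ℕP.+-mono-≤ (le d) (ℕP.≤-trans (shift-mono le′ d)
             (ℕP.≤-reflexive (shift-⊕ (poly R k) (shift (poly Q k)) d))) ⟩
      (partialSum R k d ℕ.+ shift (partialSum Q k) d) ℕ.+ (shift (poly R k) d ℕ.+ shift (shift (poly Q k)) d)
        ≡⟨ interchange ℕP.+-commutativeSemigroup (partialSum R k d) _ _ _ ⟩
      (partialSum R k d ℕ.+ shift (poly R k) d) ℕ.+ (shift (partialSum Q k) d ℕ.+ shift (shift (poly Q k)) d)
        ≡⟨ cong (λ c → (partialSum R k d ℕ.+ c d) ℕ.+ (shift (partialSum Q k) d ℕ.+ shift (shift (poly Q k)) d))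
             (sym (contribution-preceded R (prec p))) ⟩
      partialSum R (suc k) d ℕ.+ (shift (partialSum Q k) d ℕ.+ shift (shift (poly Q k)) d)
        ≡⟨ cong (λ c → partialSum R (suc k) d ℕ.+ (shift (partialSum Q k) d ℕ.+ shift c d))
             (sym (contribution-preceded Q p)) ⟩
      partialSum R (suc k) d ℕ.+ (shift (partialSum Q k) d ℕ.+ shift (contribution Q k) d)
        ≡⟨ cong (partialSum R (suc k) d ℕ.+_) (sym (shift-⊕ (partialSum Q k) (contribution Q k) d)) ⟩
      partialSum R (suc k) d ℕ.+ shift (partialSum Q (suc k)) d ∎
    where open ℕP.≤-Reasoning
  ... | level iR le′ | no ¬p = settled (λ _ → iR) λ d → begin
      partialSum Q (suc k) d
        ≡⟨ partialSum-first Q i ¬p d ⟩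
      poly Q k d
        ≤⟨ le′ d ⟩
      poly R k d ℕ.+ shift (poly Q k) d
        ≤⟨ ℕP.+-mono-≤ (poly≤partialSum R k d) (shift-poly≤shift-partialSum k d) ⟩
      partialSum R (suc k) d ℕ.+ shift (partialSum Q (suc k)) d ∎
    where open ℕP.≤-Reasoning
  -- The lowest slice of `Q` lies one step below that of `R`: this is where the lag starts.
  ... | above iR ¬iR le′ | no ¬p =
    lagging i iR ¬iR λ d → ℕP.≤-trans (ℕP.≤-reflexive (partialSum-first Q i ¬p d)) (le′ d)
  -- `R` would have nonempty slices on both sides of the empty slice `k`, against `interval`.
  ... | above iR ¬iR le′ | yes p = Empty.⊥-elim (¬iR (level-below k iR (prec p)))
    where
    level-below : ∀ k → Inhabited R (suc k) → Preceded R k → Inhabited R k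
    level-below (suc k) i p = interval R i p (ℕP.n≤1+n k)
  -- The lowest slice of `R` enters unshifted and absorbs all of `Q` below `k`; slice `k` of `Q` is
  -- preceded, hence shifted, and fits into the shifted term. The lag ends here.
  progress-step k (lagging p iR ¬pR le) = settled (λ _ → iR) λ d → begin
      partialSum Q k d ℕ.+ contribution Q k d
        ≡⟨ cong (λ c → partialSum Q k d ℕ.+ c d) (contribution-preceded Q p) ⟩
      partialSum Q k d ℕ.+ shift (poly Q k) d
        ≤⟨ ℕP.+-mono-≤ (le d) (shift-poly≤shift-partialSum k d) ⟩
      poly R k d ℕ.+ shift (partialSum Q (suc k)) d
        ≤⟨ ℕP.+-monoˡ-≤ _ (poly≤partialSum R k d) ⟩
      partialSum R (suc k) d ℕ.+ shift (partialSum Q (suc k)) d ∎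
    where open ℕP.≤-Reasoning

  progress : ∀ k → Progress k
  progress zero    = settled (λ ()) (λ d → z≤n)
  progress (suc k) = progress-step k (progress k)

  -- A lag at `k` requires slice `k` of `R` to be nonempty, so it cannot persist past the top slice.
  partialSum-cover : ∀ k → ¬ Inhabited R k → partialSum Q k ≤ₚ partialSum R k ⊕ shift (partialSum Q k)
  partialSum-cover k ¬iR with progress k
  ... | settled _ le     = le
  ... | lagging _ iR _ _ = contradiction iR ¬iR

-- Counting in lists, and vectors extended at the end.

length-filter-map : ∀ {P : B → Set} (P? : Decidable P) (f : A → B) xs →
  length (filter P? (map f xs)) ≡ length (filter (P? ∘ f) xs)
length-filter-map P? f []       = refl
length-filter-map P? f (x ∷ xs) with does (P? (f x))
... | true  = cong suc (length-filter-map P? f xs)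
... | false = length-filter-map P? f xs

-- Slicing fixes the last coordinate, so the count over indices is split at the end opposite to the
-- one where `tabulate` recurses.
length-filter-tabulate-last : ∀ {P : A → Set} (P? : Decidable P) (f : Fin (suc n) → A) →
  length (filter P? (tabulate f)) ≡
  length (filter P? (tabulate (f ∘ inject₁))) ℕ.+ (if does (P? (f (fromℕ n))) then 1 else 0)
length-filter-tabulate-last {n = zero} P? f with does (P? (f Fin.zero))
... | true  = refl
... | false = refl
length-filter-tabulate-last {n = suc n} P? f with does (P? (f Fin.zero))
... | true  = cong suc (length-filter-tabulate-last P? (f ∘ Fin.suc))
... | false = length-filter-tabulate-last P? (f ∘ Fin.suc)

length-filter-tabulate-≐ : ∀ {P : A → Set} {Q : B → Set} (P? : Decidable P) (Q? : Decidable Q)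
  (f : Fin n → A) (g : Fin n → B) →
  (∀ i → P (f i) → Q (g i)) → (∀ i → Q (g i) → P (f i)) →
  length (filter P? (tabulate f)) ≡ length (filter Q? (tabulate g))
length-filter-tabulate-≐ {n = zero}  P? Q? f g to from = refl
length-filter-tabulate-≐ {n = suc n} P? Q? f g to from
  with ih ← length-filter-tabulate-≐ P? Q? (f ∘ Fin.suc) (g ∘ Fin.suc) (to ∘ Fin.suc) (from ∘ Fin.suc)
     | P? (f Fin.zero) | Q? (g Fin.zero)
... | yes p | yes q = cong suc ih
... | no ¬p | no ¬q = ih
... | yes p | no ¬q = contradiction (to _ p) ¬q
... | no ¬p | yes q = contradiction (from _ q) ¬p

updateAt-∷ʳ-inject₁ : ∀ (a : Vec A n) {x f} i → updateAt (a ∷ʳ x) (inject₁ i) f ≡ updateAt a i f ∷ʳ x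
updateAt-∷ʳ-inject₁ (y ∷ a) Fin.zero    = refl
updateAt-∷ʳ-inject₁ (y ∷ a) (Fin.suc i) = cong (y ∷_) (updateAt-∷ʳ-inject₁ a i)

updateAt-∷ʳ-fromℕ : ∀ (a : Vec A n) {x f} → updateAt (a ∷ʳ x) (fromℕ n) f ≡ a ∷ʳ f x
updateAt-∷ʳ-fromℕ []      = refl
updateAt-∷ʳ-fromℕ (y ∷ a) = cong (y ∷_) (updateAt-∷ʳ-fromℕ a)

lookup-∷ʳ-inject₁ : ∀ (a : Vec A n) {x} i → lookup (a ∷ʳ x) (inject₁ i) ≡ lookup a i
lookup-∷ʳ-inject₁ (y ∷ a) Fin.zero    = refl
lookup-∷ʳ-inject₁ (y ∷ a) (Fin.suc i) = lookup-∷ʳ-inject₁ a i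

lookup-∷ʳ-fromℕ : ∀ (a : Vec A n) {x} → lookup (a ∷ʳ x) (fromℕ n) ≡ x
lookup-∷ʳ-fromℕ []      = refl
lookup-∷ʳ-fromℕ (y ∷ a) = lookup-∷ʳ-fromℕ a

raise : Vec ℤ n → Fin n → Vec ℤ n
raise a j = updateAt a j (λ x → x + 1ℤ)

exch-∷ʳ-inject₁ : ∀ (a : Vec ℤ n) {x} i j → exch (a ∷ʳ x) (inject₁ i) (inject₁ j) ≡ exch a i j ∷ʳ x
exch-∷ʳ-inject₁ a i j = trans
  (cong (λ v → raise v (inject₁ j)) (updateAt-∷ʳ-inject₁ a i))
  (updateAt-∷ʳ-inject₁ (updateAt a i _) j)

exch-∷ʳ-fromℕ : ∀ (a : Vec ℤ n) {x} j → exch (a ∷ʳ x) (fromℕ n) (inject₁ j) ≡ raise a j ∷ʳ (x - 1ℤ)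
exch-∷ʳ-fromℕ a j = trans
  (cong (λ v → raise v (inject₁ j)) (updateAt-∷ʳ-fromℕ a))
  (updateAt-∷ʳ-inject₁ a j)

-- The exchange property and activity.

-- The induction works with this property instead of rank functions, because slices inherit it
-- directly.
Exchange : (Vec ℤ n → Set) → Set
Exchange P = ∀ {a b} i → P a → P b → lookup b i ℤ.< lookup a i →
  ∃ λ j → lookup a j ℤ.< lookup b j × P (exch a i j)

-- Interior activity for an arbitrary set. For `InP f` it unfolds to `IntActive f`, and `active?` to
-- `IntActive?`, so the final comparison with `#Int` is definitional.
Active : (Vec ℤ n → Set) → Vec ℤ n → Fin n → Set
Active P a i = ∀ j → j Fin.< i → ¬ P (exch a i j)

active? : ∀ {P : Vec ℤ n → Set} → Decidable P → ∀ a → Decidable (Active P a)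
active? P? a i = FinP.all? (λ j → (j FinP.<? i) →-dec ¬? (P? (exch a i j)))

#active : ∀ {P : Vec ℤ n → Set} → Decidable P → Vec ℤ n → ℕ
#active {n} P? a = length (filter (active? P? a) (allFin n))

inactivity : ∀ {P : Vec ℤ n → Set} → Decidable P → Vec ℤ n → ℕ
inactivity {n} P? a = n ∸ #active P? a

#active≤n : ∀ {P : Vec ℤ n → Set} (P? : Decidable P) a → #active P? a ≤ n
#active≤n {n} P? a = ℕP.≤-trans
  (length-filter (active? P? a) (allFin n))
  (ℕP.≤-reflexive (length-tabulate (λ i → i)))

inject₁-mono-< : ∀ {i j : Fin n} → i Fin.< j → inject₁ i Fin.< inject₁ j
inject₁-mono-< {i = i} {j} = subst₂ _<_ (sym (FinP.toℕ-inject₁ i)) (sym (FinP.toℕ-inject₁ j))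

inject₁-cancel-< : ∀ {i j : Fin n} → inject₁ i Fin.< inject₁ j → i Fin.< j
inject₁-cancel-< {i = i} {j} = subst₂ _<_ (FinP.toℕ-inject₁ i) (FinP.toℕ-inject₁ j)

inject₁<fromℕ : ∀ (i : Fin n) → inject₁ i Fin.< fromℕ n
inject₁<fromℕ {n} i = subst (Fin.toℕ (inject₁ i) <_) (sym (FinP.toℕ-fromℕ n)) (FinP.inject₁ℕ< i)

module _ {P : Vec ℤ (suc n) → Set} (P? : Decidable P) (a : Vec ℤ n) (x : ℤ) where

  -- Activity of an earlier index only tests exchanges with still earlier indices, and these leave
  -- the last coordinate alone.
  #active-∷ʳ : #active P? (a ∷ʳ x) ≡
    #active (λ b → P? (b ∷ʳ x)) a ℕ.+ (if does (active? P? (a ∷ʳ x) (fromℕ n)) then 1 else 0)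
  #active-∷ʳ = trans
    (length-filter-tabulate-last (active? P? (a ∷ʳ x)) (λ i → i))
    (cong (ℕ._+ (if does (active? P? (a ∷ʳ x) (fromℕ n)) then 1 else 0))
      (length-filter-tabulate-≐ (active? P? (a ∷ʳ x)) (active? (λ b → P? (b ∷ʳ x)) a)
        inject₁ (λ i → i) to from))
    where
    to : ∀ i → Active P (a ∷ʳ x) (inject₁ i) → Active (λ b → P (b ∷ʳ x)) a i
    to i act j j<i p = act (inject₁ j) (inject₁-mono-< j<i) (subst P (sym (exch-∷ʳ-inject₁ a i j)) p)

    from : ∀ i → Active (λ b → P (b ∷ʳ x)) a i → Active P (a ∷ʳ x) (inject₁ i)
    from i act j j<i p with view j
    ... | ‵fromℕ     = ℕP.<-asym j<i (inject₁<fromℕ i)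
    ... | ‵inject₁ j = act j (inject₁-cancel-< j<i) (subst P (exch-∷ʳ-inject₁ a i j) p)

  inactivity-active-last : Active P (a ∷ʳ x) (fromℕ n) →
    inactivity P? (a ∷ʳ x) ≡ inactivity (λ b → P? (b ∷ʳ x)) a
  inactivity-active-last act
    rewrite #active-∷ʳ | dec-true (active? P? (a ∷ʳ x) (fromℕ n)) act
    = cong (suc n ∸_) (ℕP.+-comm (#active (λ b → P? (b ∷ʳ x)) a) 1)

  inactivity-inactive-last : ¬ Active P (a ∷ʳ x) (fromℕ n) →
    inactivity P? (a ∷ʳ x) ≡ suc (inactivity (λ b → P? (b ∷ʳ x)) a)
  inactivity-inactive-last ¬act
    rewrite #active-∷ʳ | dec-false (active? P? (a ∷ʳ x) (fromℕ n)) ¬act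
          | ℕP.+-identityʳ (#active (λ b → P? (b ∷ʳ x)) a)
    -- The bound keeps the truncated subtraction exact.
    = ℕP.+-∸-assoc 1 (#active≤n (λ b → P? (b ∷ʳ x)) a)

-- Exchange sets in a common cube and their slices.

-- All sets live in one cube with the values lo, ..., lo + M - 1 in every coordinate, so slices of
-- different sets are compared at the same natural number.
module Grid (lo : ℤ) (M : ℕ) where

  coord : ℕ → ℤ
  coord k = lo + ℤ.+ k

  coord-pred : ∀ k → coord (suc k) - 1ℤ ≡ coord k
  coord-pred k = lemma lo (ℤ.+ k)
    where
    lemma : ∀ l k → (l + (1ℤ + k)) - 1ℤ ≡ l + k
    lemma = solve-∀

  coord-suc : ∀ k → coord k + 1ℤ ≡ coord (suc k)
  coord-suc k = lemma lo (ℤ.+ k)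
    where
    lemma : ∀ l k → (l + k) + 1ℤ ≡ l + (1ℤ + k)
    lemma = solve-∀

  coord-mono-< : ∀ {k m} → k < m → coord k ℤ.< coord m
  coord-mono-< k<m = ℤP.+-monoʳ-< lo (ℤ.+<+ k<m)

  lower-∷ʳ-coord : ∀ (a : Vec ℤ n) j k → exch (a ∷ʳ coord (suc k)) (fromℕ n) (inject₁ j) ≡ raise a j ∷ʳ coord k
  lower-∷ʳ-coord a j k = trans (exch-∷ʳ-fromℕ a j) (cong (raise a j ∷ʳ_) (coord-pred k))

  -- Grouping by the last coordinate makes a count over the grid split in the same way as
  -- `partialSum`.
  layers : List (Vec ℤ n) → ℕ → List (Vec ℤ (suc n))
  layers g zero    = []
  layers g (suc k) = layers g k ++ map (_∷ʳ coord k) g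

  grid : ∀ n → List (Vec ℤ n)
  grid zero    = [] ∷ []
  grid (suc n) = layers (grid n) M

  ∈-layers⁻ : ∀ {g : List (Vec ℤ n)} k {v} → v ∈ₗ layers g k →
    ∃ λ m → m < k × ∃ λ a → a ∈ₗ g × v ≡ a ∷ʳ coord m
  ∈-layers⁻ {g = g} (suc k) v∈ with ∈-++⁻ (layers g k) v∈
  ... | inj₁ v∈k with m , m<k , rest ← ∈-layers⁻ k v∈k = m , ℕP.m<n⇒m<1+n m<k , rest
  ... | inj₂ v∈m with a , a∈g , eq ← ∈-map⁻ (_∷ʳ coord k) v∈m = k , ℕP.n<1+n k , a , a∈g , eq

  -- Takes the place of a polymatroid in the induction; `gridPoly` is its interior polynomial.
  record ExchangeSet (n : ℕ) : Set₁ where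
    field
      Mem      : Vec ℤ n → Set
      mem?     : Decidable Mem
      inGrid   : ∀ {a} → Mem a → a ∈ₗ grid n
      exchange : Exchange Mem

    counted? : ∀ d → Decidable (λ a → Mem a × inactivity mem? a ≡ d)
    counted? d a = mem? a ×-dec (inactivity mem? a ℕ.≟ d)

    gridPoly : Poly
    gridPoly d = length (filter (counted? d) (grid n))

  open ExchangeSet

  slice : ExchangeSet (suc n) → ℕ → ExchangeSet n
  slice X k .Mem a  = Mem X (a ∷ʳ coord k)
  slice X k .mem? a = mem? X (a ∷ʳ coord k)
  slice X k .inGrid {a} p with _ , _ , b , b∈ , eq ← ∈-layers⁻ M (inGrid X p)
    = subst (_∈ₗ grid _) (sym (∷ʳ-injectiveˡ a b eq)) b∈
  slice X k .exchange {a} {b} i p q b<a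
    with exchange X (inject₁ i) p q (subst₂ ℤ._<_ (sym (lookup-∷ʳ-inject₁ b i)) (sym (lookup-∷ʳ-inject₁ a i)) b<a)
  ... | j , a<b , r with view j
  -- An exchange raises a coordinate in which the two points differ; in a slice they agree in the
  -- last one.
  ... | ‵fromℕ     = contradiction a<b (ℤP.<-irrefl (trans (lookup-∷ʳ-fromℕ a) (sym (lookup-∷ʳ-fromℕ b))))
  ... | ‵inject₁ j = j
                   , subst₂ ℤ._<_ (lookup-∷ʳ-inject₁ a j) (lookup-∷ʳ-inject₁ b j) a<b
                   , subst (Mem X) (exch-∷ʳ-inject₁ a i j) r

  outside-grid : ∀ (X : ExchangeSet (suc n)) {a x} → (∀ {m} → m < M → ¬ x ≡ coord m) → ¬ Mem X (a ∷ʳ x)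
  outside-grid X {a} out p with m , m<M , b , _ , eq ← ∈-layers⁻ M (inGrid X p)
    = out m<M (∷ʳ-injectiveʳ a b eq)

  -- Exchange at the last coordinate against a point of a lower slice: the coordinate raised in
  -- return must be an earlier one, since `a` exceeds `b` in the last. This gives `interval`,
  -- `growth` and the inactivity of the last coordinate.
  lower-last : ∀ (X : ExchangeSet (suc n)) {k m a b} → m ≤ k →
    Mem (slice X (suc k)) a → Mem (slice X m) b → ∃ λ j → Mem (slice X k) (raise a j)
  lower-last {n} X {k} {m} {a} {b} m≤k p q
    with exchange X (fromℕ n) p q
           (subst₂ ℤ._<_ (sym (lookup-∷ʳ-fromℕ b)) (sym (lookup-∷ʳ-fromℕ a)) (coord-mono-< (s≤s m≤k)))
  ... | j , a<b , r with view j
  ... | ‵fromℕ     = contradiction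
          (subst₂ ℤ._<_ (lookup-∷ʳ-fromℕ a) (lookup-∷ʳ-fromℕ b) a<b)
          (ℤP.<-asym (coord-mono-< (s≤s m≤k)))
  ... | ‵inject₁ j = j , subst (Mem X) (lower-∷ʳ-coord a j k) r

  -- Simultaneous induction on the dimension.

  -- `CoverMono` is inequality (B).
  Mono CoverMono : ℕ → Set₁
  Mono n = ∀ (X Y : ExchangeSet n) → (∀ {a} → Mem X a → Mem Y a) → gridPoly X ≤ₚ gridPoly Y
  CoverMono n = ∀ (Q R : ExchangeSet n) → (∀ {a} → Mem Q a → ∃ λ j → Mem R (raise a j)) →
    gridPoly Q ≤ₚ gridPoly R ⊕ shift (gridPoly Q)

  gridPoly-empty : ∀ (X : ExchangeSet n) → (∀ {a} → ¬ Mem X a) → ∀ d → gridPoly X d ≡ 0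
  gridPoly-empty X empty d = cong length
    (filter-none (counted? X d) {xs = grid _} (All.universal (λ a → empty ∘ proj₁) _))

  module _ (coverMono : CoverMono n) where

    slices : ExchangeSet (suc n) → SliceFamily
    slices X .poly k       = gridPoly (slice X k)
    slices X .Inhabited k  = ∃ (Mem (slice X k))
    slices X .inhabited? k = map′
      (λ m → let a , _ , p = find m in a , p)
      (λ (a , p) → lose (inGrid (slice X k) p) p)
      (any? (mem? (slice X k)) (grid n))
    slices X .vanishes {k} ¬i = gridPoly-empty (slice X k) (λ p → ¬i (_ , p))
    slices X .interval (_ , p) (_ , q) m≤k = let _ , r = lower-last X m≤k p q in _ , r
    slices X .growth {k} _ (_ , q) =
      coverMono (slice X (suc k)) (slice X k) (λ p → lower-last X ℕP.≤-refl p q)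

    -- Lowering the last coordinate leads into the slice directly below, which is empty, or out of
    -- the grid when `k` is zero.
    active-last : ∀ (X : ExchangeSet (suc n)) {k a} → ¬ Preceded (slices X) k →
      Active (Mem X) (a ∷ʳ coord k) (fromℕ n)
    active-last X {k} {a} ¬p j j<n r with view j
    ... | ‵fromℕ = ℕP.<-irrefl refl j<n
    active-last X {zero}  {a} ¬p _ j<n r | ‵inject₁ j =
      outside-grid X (λ {m} _ eq → ℤP.<-irrefl eq (below m)) (subst (Mem X) (exch-∷ʳ-fromℕ a j) r)
      where
      below : ∀ m → coord 0 - 1ℤ ℤ.< coord m
      below m = subst (ℤ._< coord m) (sym (ℤP.+-assoc lo (ℤ.+ 0) (- 1ℤ))) (ℤP.+-monoʳ-< lo ℤ.-<+)
    active-last X {suc k} {a} ¬p _ j<n r | ‵inject₁ j =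
      ¬p (_ , subst (Mem X) (lower-∷ʳ-coord a j k) r)

    inactive-last : ∀ (X : ExchangeSet (suc n)) {k a} → Mem (slice X k) a → Preceded (slices X) k →
      ¬ Active (Mem X) (a ∷ʳ coord k) (fromℕ n)
    inactive-last X {suc k} {a} p (_ , q) act =
      let j , r = lower-last X ℕP.≤-refl p q in
      act (inject₁ j) (inject₁<fromℕ j)
        (subst (Mem X) (sym (lower-∷ʳ-coord a j k)) r)

    -- Within one layer the last coordinate is active at all members or at none, so the layer as a
    -- whole carries the factor 1 or x.
    length-filter-layer : ∀ (X : ExchangeSet (suc n)) k d →
      length (filter (counted? X d) (map (_∷ʳ coord k) (grid n))) ≡ contribution (slices X) k d
    length-filter-layer X k d with preceded? (slices X) k
    ... | no ¬p = begin
        length (filter (counted? X d) (map (_∷ʳ coord k) (grid n)))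
          ≡⟨ length-filter-map (counted? X d) (_∷ʳ coord k) (grid n) ⟩
        length (filter (counted? X d ∘ (_∷ʳ coord k)) (grid n))
          ≡⟨ cong length (filter-≐ (counted? X d ∘ (_∷ʳ coord k)) (counted? (slice X k) d)
              ( (λ {a} (p , eq) → p , trans (sym (inactivity-∷ʳ a)) eq)
              , (λ {a} (p , eq) → p , trans (inactivity-∷ʳ a) eq)) (grid n)) ⟩
        gridPoly (slice X k) d
          ≡⟨ cong (λ c → c d) (contribution-first (slices X) ¬p) ⟨
        contribution (slices X) k d ∎
      where
      open ≡-Reasoning
      inactivity-∷ʳ : ∀ a → inactivity (mem? X) (a ∷ʳ coord k) ≡ inactivity (mem? (slice X k)) a
      inactivity-∷ʳ a = inactivity-active-last (mem? X) a (coord k) (active-last X ¬p)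
    ... | yes p = trans (length-filter-map (counted? X d) (_∷ʳ coord k) (grid n))
        (trans (lemma d) (cong (λ c → c d) (sym (contribution-preceded (slices X) p))))
      where
      inactivity-∷ʳ : ∀ {a} → Mem (slice X k) a →
        inactivity (mem? X) (a ∷ʳ coord k) ≡ suc (inactivity (mem? (slice X k)) a)
      inactivity-∷ʳ {a} q = inactivity-inactive-last (mem? X) a (coord k) (inactive-last X q p)
      lemma : ∀ d → length (filter (counted? X d ∘ (_∷ʳ coord k)) (grid n)) ≡ shift (gridPoly (slice X k)) d
      lemma zero    = cong length (filter-none (counted? X 0 ∘ (_∷ʳ coord k)) {xs = grid n}
        (All.universal (λ a (q , eq) → ℕP.0≢1+n (trans (sym eq) (inactivity-∷ʳ q))) _))
      lemma (suc d) = cong length (filter-≐ (counted? X (suc d) ∘ (_∷ʳ coord k)) (counted? (slice X k) d)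
        ( (λ (q , eq) → q , ℕP.suc-injective (trans (sym (inactivity-∷ʳ q)) eq))
        , (λ (q , eq) → q , trans (inactivity-∷ʳ q) (cong suc eq))) (grid n))

    gridPoly-slices : ∀ (X : ExchangeSet (suc n)) d → gridPoly X d ≡ partialSum (slices X) M d
    gridPoly-slices X d = go M
      where
      go : ∀ k → length (filter (counted? X d) (layers (grid n) k)) ≡ partialSum (slices X) k d
      go zero    = refl
      go (suc k) = begin
        length (filter (counted? X d) (layers (grid n) k ++ map (_∷ʳ coord k) (grid n)))
          ≡⟨ cong length (filter-++ (counted? X d) (layers (grid n) k) _) ⟩
        length (filter (counted? X d) (layers (grid n) k) ++ filter (counted? X d) (map (_∷ʳ coord k) (grid n)))
          ≡⟨ length-++ (filter (counted? X d) (layers (grid n) k)) ⟩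
        length (filter (counted? X d) (layers (grid n) k)) ℕ.+ length (filter (counted? X d) (map (_∷ʳ coord k) (grid n)))
          ≡⟨ cong₂ ℕ._+_ (go k) (length-filter-layer X k d) ⟩
        partialSum (slices X) (suc k) d ∎
        where open ≡-Reasoning

    module _ (mono : Mono n) where

      mono-suc : Mono (suc n)
      mono-suc X Y X⊆Y d = subst₂ _≤_ (sym (gridPoly-slices X d)) (sym (gridPoly-slices Y d))
        (partialSum-mono (slices X) (slices Y)
          (λ (a , p) → a , X⊆Y p)
          (λ k → mono (slice X k) (slice Y k) X⊆Y) M d)

      raise-∷ʳ-fromℕ : ∀ (a : Vec ℤ n) k → raise (a ∷ʳ coord k) (fromℕ n) ≡ a ∷ʳ coord (suc k)
      raise-∷ʳ-fromℕ a k = trans (updateAt-∷ʳ-fromℕ a) (cong (a ∷ʳ_) (coord-suc k))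

      coverMono-suc : CoverMono (suc n)
      coverMono-suc Q R cover d = begin
        gridPoly Q d
          ≡⟨ gridPoly-slices Q d ⟩
        partialSum (slices Q) M d
          ≤⟨ partialSum-cover (slices Q) (slices R) covers M empty-top d ⟩
        partialSum (slices R) M d ℕ.+ shift (partialSum (slices Q) M) d
          ≡⟨ cong₂ ℕ._+_ (sym (gridPoly-slices R d)) (shift-gridPoly d) ⟩
        gridPoly R d ℕ.+ shift (gridPoly Q) d ∎
        where
        open ℕP.≤-Reasoning

        shift-gridPoly : ∀ d → shift (partialSum (slices Q) M) d ≡ shift (gridPoly Q) d
        shift-gridPoly zero    = refl
        shift-gridPoly (suc d) = sym (gridPoly-slices Q d)

        -- The topmost layer of the grid has index M - 1.
        empty-top : ¬ Inhabited (slices R) M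
        empty-top (_ , p) = outside-grid R (λ m<M eq → ℤP.<-irrefl (sym eq) (coord-mono-< m<M)) p

        covers : ∀ {k} → Inhabited (slices Q) k → Covers (slices Q) (slices R) k
        covers {k} (a , p) with inhabited? (slices R) k
        ... | yes (b , q) = level (_ , proj₂ (cover-level p)) (coverMono (slice Q k) (slice R k) cover-level)
          where
          cover-level : ∀ {a} → Mem (slice Q k) a → ∃ λ j → Mem (slice R k) (raise a j)
          cover-level {a} p with j , r ← cover p with view j
          -- The raised point is in slice `suc k` of `R`. As slice `k` is nonempty, the unit gained
          -- in the last coordinate can be exchanged for one in an earlier coordinate.
          ... | ‵fromℕ     = lower-last R ℕP.≤-refl (subst (Mem R) (raise-∷ʳ-fromℕ a k) r) q
          ... | ‵inject₁ j = j , subst (Mem R) (updateAt-∷ʳ-inject₁ a j) r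
        ... | no ¬i = above (_ , cover-above p) ¬i (mono (slice Q k) (slice R (suc k)) cover-above)
          where
          cover-above : ∀ {a} → Mem (slice Q k) a → Mem (slice R (suc k)) a
          cover-above {a} p with j , r ← cover p with view j
          ... | ‵fromℕ     = subst (Mem R) (raise-∷ʳ-fromℕ a k) r
          -- Raising an earlier coordinate would stay in slice `k` of `R`, which is empty.
          ... | ‵inject₁ j = contradiction (_ , subst (Mem R) (updateAt-∷ʳ-inject₁ a j) r) ¬i

  mono-zero : Mono 0
  mono-zero X Y X⊆Y d with mem? X [] | mem? Y [] | d
  ... | no _  | _     | _     = z≤n
  ... | yes p | no ¬q | _     = contradiction (X⊆Y p) ¬q
  ... | yes _ | yes _ | zero  = ℕP.≤-refl
  ... | yes _ | yes _ | suc _ = z≤n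

  -- With no coordinate to raise, the covering hypothesis forces `Q` to be empty.
  coverMono-zero : CoverMono 0
  coverMono-zero Q R cover d = ℕP.≤-trans (ℕP.≤-reflexive (gridPoly-empty Q empty d)) z≤n
    where
    empty : ∀ {a} → ¬ Mem Q a
    empty p with () , _ ← cover p

  monotone : ∀ n → CoverMono n × Mono n
  monotone zero    = coverMono-zero , mono-zero
  monotone (suc n) = let c , m = monotone n in coverMono-suc c m , mono-suc c m

  gridPoly-mono : Mono n
  gridPoly-mono = proj₂ (monotone _)

-- Coordinate sums over subsets.

sumOn-⊥ : ∀ (a : Vec ℤ n) → sumOn ⊥ a ≡ 0ℤ
sumOn-⊥ []      = refl
sumOn-⊥ (x ∷ a) = sumOn-⊥ a

sumOn-∪-∩ : ∀ (A B : Subset n) a → sumOn (A ∪ B) a + sumOn (A ∩ B) a ≡ sumOn A a + sumOn B a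
sumOn-∪-∩ []            []            []      = refl
sumOn-∪-∩ (inside  ∷ A) (inside  ∷ B) (x ∷ a) = trans (lemma x _ _)
  (trans (cong (λ s → x + (x + s)) (sumOn-∪-∩ A B a)) (sym (lemma x _ _)))
  where
  lemma : ∀ x s t → (x + s) + (x + t) ≡ x + (x + (s + t))
  lemma = solve-∀
sumOn-∪-∩ (inside  ∷ A) (outside ∷ B) (x ∷ a) = trans (ℤP.+-assoc x _ _)
  (trans (cong (x +_) (sumOn-∪-∩ A B a)) (sym (ℤP.+-assoc x _ _)))
sumOn-∪-∩ (outside ∷ A) (inside  ∷ B) (x ∷ a) = trans (ℤP.+-assoc x _ _)
  (trans (cong (x +_) (sumOn-∪-∩ A B a)) (lemma x (sumOn A a) (sumOn B a)))
  where
  lemma : ∀ x s t → x + (s + t) ≡ s + (x + t)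
  lemma = solve-∀
sumOn-∪-∩ (outside ∷ A) (outside ∷ B) (x ∷ a) = sumOn-∪-∩ A B a

sumOn-∁ : ∀ (I : Subset n) a → sumOn (∁ I) a + sumOn I a ≡ sumOn ⊤ a
sumOn-∁ []            []      = refl
sumOn-∁ (inside  ∷ I) (x ∷ a) = trans (lemma x (sumOn (∁ I) a) (sumOn I a)) (cong (x +_) (sumOn-∁ I a))
  where
  lemma : ∀ x s t → s + (x + t) ≡ x + (s + t)
  lemma = solve-∀
sumOn-∁ (outside ∷ I) (x ∷ a) = trans (ℤP.+-assoc x _ _) (cong (x +_) (sumOn-∁ I a))

neg : Vec ℤ n → Vec ℤ n
neg = Vec.map (λ x → - x)

sumOn-neg : ∀ (I : Subset n) a → sumOn I (neg a) ≡ - sumOn I a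
sumOn-neg []            []      = refl
sumOn-neg (inside  ∷ I) (x ∷ a) = trans (cong (- x +_) (sumOn-neg I a)) (sym (ℤP.neg-distrib-+ x _))
sumOn-neg (outside ∷ I) (x ∷ a) = sumOn-neg I a

sumOn-mono-≤ : ∀ (I : Subset n) {a b} → (∀ {j} → j ∈ I → lookup a j ℤ.≤ lookup b j) → sumOn I a ℤ.≤ sumOn I b
sumOn-mono-≤ []            {[]}    {[]}    a≤b = ℤP.≤-refl
sumOn-mono-≤ (inside  ∷ I) {x ∷ a} {y ∷ b} a≤b = ℤP.+-mono-≤ (a≤b here) (sumOn-mono-≤ I (a≤b ∘ there))
sumOn-mono-≤ (outside ∷ I) {x ∷ a} {y ∷ b} a≤b = sumOn-mono-≤ I (a≤b ∘ there)

sumOn-mono-< : ∀ (I : Subset n) {a b i} → (∀ {j} → j ∈ I → lookup a j ℤ.≤ lookup b j) →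
  i ∈ I → lookup a i ℤ.< lookup b i → sumOn I a ℤ.< sumOn I b
sumOn-mono-< (inside  ∷ I) {x ∷ a} {y ∷ b} a≤b here        x<y = ℤP.+-mono-<-≤ x<y (sumOn-mono-≤ I (a≤b ∘ there))
sumOn-mono-< (inside  ∷ I) {x ∷ a} {y ∷ b} a≤b (there i∈I) a<b = ℤP.+-mono-≤-< (a≤b here) (sumOn-mono-< I (a≤b ∘ there) i∈I a<b)
sumOn-mono-< (outside ∷ I) {x ∷ a} {y ∷ b} a≤b (there i∈I) a<b = sumOn-mono-< I (a≤b ∘ there) i∈I a<b

sumOn-updateAt-∈ : ∀ {I : Subset n} {i} c a → i ∈ I → sumOn I (updateAt a i (_+ c)) ≡ sumOn I a + c
sumOn-updateAt-∈ {I = inside ∷ I}  c (x ∷ a) here = lemma x c _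
  where
  lemma : ∀ x c s → (x + c) + s ≡ (x + s) + c
  lemma = solve-∀
sumOn-updateAt-∈ {I = inside ∷ I}  c (x ∷ a) (there i∈I) =
  trans (cong (x +_) (sumOn-updateAt-∈ c a i∈I)) (sym (ℤP.+-assoc x _ c))
sumOn-updateAt-∈ {I = outside ∷ I} c (x ∷ a) (there i∈I) = sumOn-updateAt-∈ c a i∈I

sumOn-updateAt-∉ : ∀ {I : Subset n} {i f} a → i ∉ I → sumOn I (updateAt a i f) ≡ sumOn I a
sumOn-updateAt-∉ {I = inside  ∷ I} {Fin.zero}  (x ∷ a) i∉I = contradiction here i∉I
sumOn-updateAt-∉ {I = outside ∷ I} {Fin.zero}  (x ∷ a) i∉I = refl
sumOn-updateAt-∉ {I = inside  ∷ I} {Fin.suc i} (x ∷ a) i∉I = cong (x +_) (sumOn-updateAt-∉ a (i∉I ∘ there))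
sumOn-updateAt-∉ {I = outside ∷ I} {Fin.suc i} (x ∷ a) i∉I = sumOn-updateAt-∉ a (i∉I ∘ there)

sumOn-⁅⁆ : ∀ (a : Vec ℤ n) i → sumOn ⁅ i ⁆ a ≡ lookup a i
sumOn-⁅⁆ (x ∷ a) Fin.zero    = trans (cong (x +_) (sumOn-⊥ a)) (ℤP.+-identityʳ x)
sumOn-⁅⁆ (x ∷ a) (Fin.suc i) = sumOn-⁅⁆ a i

sumOn-minus : ∀ (a : Vec ℤ n) i → sumOn (⊤ minus i) a + lookup a i ≡ sumOn ⊤ a
sumOn-minus (x ∷ a) Fin.zero    = trans (cong (_+ x) (go a)) (ℤP.+-comm _ x)
  where
  -- Removing the first index leaves `⊤ ─ ⊥` on the others, which becomes `⊤` only by induction.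
  go : ∀ {n} (a : Vec ℤ n) → sumOn (⊤ ─ ⊥) a ≡ sumOn ⊤ a
  go []      = refl
  go (x ∷ a) = cong (x +_) (go a)
sumOn-minus (x ∷ a) (Fin.suc i) = trans (ℤP.+-assoc x _ _) (cong (x +_) (sumOn-minus a i))

x-1+1≡x : ∀ x → (x - 1ℤ) + 1ℤ ≡ x
x-1+1≡x = solve-∀

-- Tight sets and the exchange property of polymatroids.

module _ {f : Subset n → ℤ} where

  Tight : Vec ℤ n → Subset n → Set
  Tight a T = sumOn T a ≡ f T

  -- Only sets containing `j` but not `i` have their sum increased, and by one. Such sets are not
  -- tight, and by integrality they have room for one more unit.
  exch-∈P : ∀ {a i j} → InP f a → (∀ T → Tight a T → j ∈ T → i ∈ T) → InP f (exch a i j)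
  exch-∈P {a} {i} {j} (a≤f , total) tight = bound , trans (both ∈⊤ ∈⊤) total
    where
    lowered : Vec ℤ n
    lowered = updateAt a i (_- 1ℤ)

    both : ∀ {I} → i ∈ I → j ∈ I → sumOn I (exch a i j) ≡ sumOn I a
    both i∈I j∈I = trans (sumOn-updateAt-∈ 1ℤ lowered j∈I)
      (trans (cong (_+ 1ℤ) (sumOn-updateAt-∈ (- 1ℤ) a i∈I)) (x-1+1≡x _))

    bound : ∀ I → sumOn I (exch a i j) ℤ.≤ f I
    bound I with i ∈? I | j ∈? I
    ... | yes i∈I | yes j∈I = subst (ℤ._≤ f I) (sym (both i∈I j∈I)) (a≤f I)
    ... | yes i∈I | no  j∉I = subst (ℤ._≤ f I)
      (sym (trans (sumOn-updateAt-∉ lowered j∉I) (sumOn-updateAt-∈ (- 1ℤ) a i∈I)))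
      (ℤP.≤-trans (ℤP.i≤j⇒i-k≤j 1ℤ ℤP.≤-refl) (a≤f I))
    ... | no  i∉I | no  j∉I = subst (ℤ._≤ f I)
      (sym (trans (sumOn-updateAt-∉ lowered j∉I) (sumOn-updateAt-∉ a i∉I))) (a≤f I)
    ... | no  i∉I | yes j∈I = subst (ℤ._≤ f I)
      (sym (trans (sumOn-updateAt-∈ 1ℤ lowered j∈I)
             (trans (cong (_+ 1ℤ) (sumOn-updateAt-∉ a i∉I)) (ℤP.+-comm (sumOn I a) 1ℤ))))
      (ℤP.i<j⇒suc[i]≤j (ℤP.≤∧≢⇒< (a≤f I) (λ t → i∉I (tight I t j∈I))))

  module _ (rank : IsPolymatroidRank f) where

    -- Coordinate sums are modular and `f` is submodular: a gap at the union, together with the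
    -- bound at the intersection, would contradict submodularity.
    Tight-∪ : ∀ {a A B} → InP f a → Tight a A → Tight a B → Tight a (A ∪ B)
    Tight-∪ {a} {A} {B} (a≤f , _) tA tB = ℤP.≤-antisym (a≤f (A ∪ B)) (ℤP.≮⇒≥ λ a<f → ℤP.<-irrefl refl (begin-strict
      sumOn A a + sumOn B a             ≡⟨ sumOn-∪-∩ A B a ⟨
      sumOn (A ∪ B) a + sumOn (A ∩ B) a <⟨ ℤP.+-mono-<-≤ a<f (a≤f (A ∩ B)) ⟩
      f (A ∪ B) + f (A ∩ B)             ≤⟨ proj₂ rank A B ⟩
      f A + f B                         ≡⟨ cong₂ _+_ tA tB ⟨
      sumOn A a + sumOn B a             ∎))
      where open ℤP.≤-Reasoning

    -- If no j worked, every j with a_j < b_j would lie in a tight set avoiding i. On the union U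
    -- of these, b(U) ≤ f(U) = a(U), while b ≤ a off U, strictly at i: the totals would differ.
    exchange-InP : Exchange (InP f)
    exchange-InP {a} {b} i a∈P b∈P b<a
      with FinP.any? (λ j → (lookup a j ℤ.<? lookup b j) ×-dec InP? f (exch a i j))
    ... | yes found = found
    ... | no ¬found = Empty.⊥-elim (ℤP.<-irrefl (trans (proj₂ b∈P) (sym (proj₂ a∈P))) (begin-strict
        sumOn ⊤ b                 ≡⟨ sumOn-∁ U b ⟨
        sumOn (∁ U) b + sumOn U b <⟨ ℤP.+-mono-<-≤ (sumOn-mono-< (∁ U) b≤a (x∉p⇒x∈∁p i∉U) b<a)
                                      (ℤP.≤-trans (proj₁ b∈P U) (ℤP.≤-reflexive (sym tight))) ⟩
        sumOn (∁ U) a + sumOn U a ≡⟨ sumOn-∁ U a ⟩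
        sumOn ⊤ a                 ∎))
      where
      open ℤP.≤-Reasoning

      separate : ∀ j → lookup a j ℤ.< lookup b j → ∃ λ T → Tight a T × j ∈ T × i ∉ T
      separate j a<b with anySubset? (λ T → (sumOn T a ℤ.≟ f T) ×-dec (j ∈? T) ×-dec ¬? (i ∈? T))
      ... | yes sep = sep
      ... | no ¬sep = contradiction (j , a<b , exch-∈P a∈P i∈T) ¬found
        where
        i∈T : ∀ T → Tight a T → j ∈ T → i ∈ T
        i∈T T t j∈T with i ∈? T
        ... | yes i∈T = i∈T
        ... | no  i∉T = contradiction (T , t , j∈T , i∉T) ¬sep

      collect : ∀ js → ∃ λ U → Tight a U × i ∉ U × (∀ {j} → j ∈ₗ js → lookup a j ℤ.< lookup b j → j ∈ U)
      collect []       = ⊥ , trans (sumOn-⊥ a) (sym (proj₁ rank)) , ∉⊥ , λ ()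
      collect (j ∷ js) with U , tU , i∉U , catch ← collect js | lookup a j ℤ.<? lookup b j
      ... | no  a≮b = U , tU , i∉U , λ { (here refl) a<b → contradiction a<b a≮b ; (there j∈) → catch j∈ }
      ... | yes a<b with T , tT , j∈T , i∉T ← separate j a<b =
        T ∪ U , Tight-∪ a∈P tT tU , [ i∉T , i∉U ]′ ∘ x∈p∪q⁻ T U ,
        λ { (here refl) _ → x∈p∪q⁺ (inj₁ j∈T) ; (there j∈) a<b → x∈p∪q⁺ (inj₂ (catch j∈ a<b)) }

      U : Subset n
      U = proj₁ (collect (allFin n))
      tight : Tight a U
      tight = proj₁ (proj₂ (collect (allFin n)))
      i∉U : i ∉ U
      i∉U = proj₁ (proj₂ (proj₂ (collect (allFin n))))
      b≤a : ∀ {j} → j ∈ ∁ U → lookup b j ℤ.≤ lookup a j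
      b≤a {j} j∈∁U = ℤP.≮⇒≥ (x∈∁p⇒x∉p j∈∁U ∘ proj₂ (proj₂ (proj₂ (collect (allFin n)))) (∈-allFin j))

-- Duality by negation.

-- The rank function of -P.
dual : (Subset n → ℤ) → Subset n → ℤ
dual f I = f (∁ I) - f ⊤

module _ {n : ℕ} where
  open BooleanAlgebra (∪-∩-booleanAlgebra n) public using ()
    renaming (deMorgan₁ to ∁-∩; deMorgan₂ to ∁-∪; ¬-involutive to ∁-involutive; ¬⊥≈⊤ to ∁-⊥; ¬⊤≈⊥ to ∁-⊤)

dual-rank : ∀ {f : Subset n → ℤ} → IsPolymatroidRank f → IsPolymatroidRank (dual f)
dual-rank {n} {f} (f⊥≡0 , submodular) =
    trans (cong (λ I → f I - f ⊤) ∁-⊥) (ℤP.+-inverseʳ (f ⊤))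
  , λ A B → begin
      (f (∁ (A ∪ B)) - f ⊤) + (f (∁ (A ∩ B)) - f ⊤)
        ≡⟨ cong₂ (λ I J → (f I - f ⊤) + (f J - f ⊤)) (∁-∪ A B) (∁-∩ A B) ⟩
      (f (∁ A ∩ ∁ B) - f ⊤) + (f (∁ A ∪ ∁ B) - f ⊤)
        ≡⟨ swap (f (∁ A ∩ ∁ B)) (f (∁ A ∪ ∁ B)) (f ⊤) ⟩
      (f (∁ A ∪ ∁ B) + f (∁ A ∩ ∁ B)) + (- f ⊤ - f ⊤)
        ≤⟨ ℤP.+-monoˡ-≤ (- f ⊤ - f ⊤) (submodular (∁ A) (∁ B)) ⟩
      (f (∁ A) + f (∁ B)) + (- f ⊤ - f ⊤)
        ≡⟨ regroup (f (∁ A)) (f (∁ B)) (f ⊤) ⟩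
      (f (∁ A) - f ⊤) + (f (∁ B) - f ⊤) ∎
  where
  open ℤP.≤-Reasoning
  swap : ∀ x y t → (x - t) + (y - t) ≡ (y + x) + (- t - t)
  swap = solve-∀
  regroup : ∀ x y t → (x + y) + (- t - t) ≡ (x - t) + (y - t)
  regroup = solve-∀

dual-involutive : ∀ {f : Subset n → ℤ} → f ⊥ ≡ 0ℤ → ∀ I → dual (dual f) I ≡ f I
dual-involutive {f = f} f⊥≡0 I = trans
  (cong₂ (λ x y → (x - f ⊤) - (y - f ⊤)) (cong f (∁-involutive I)) (trans (cong f ∁-⊤) f⊥≡0))
  (lemma (f I) (f ⊤))
  where
  lemma : ∀ x t → (x - t) - (0ℤ - t) ≡ x
  lemma = solve-∀

neg-involutive : ∀ (a : Vec ℤ n) → neg (neg a) ≡ a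
neg-involutive []      = refl
neg-involutive (x ∷ a) = cong₂ _∷_ (ℤP.neg-involutive x) (neg-involutive a)

InP-resp : ∀ {f g : Subset n → ℤ} {a} → (∀ I → f I ≡ g I) → InP f a → InP g a
InP-resp f≡g (a≤f , total) = (λ I → subst (_ ℤ.≤_) (f≡g I) (a≤f I)) , trans total (f≡g ⊤)

-- As the total is fixed, the upper bound on the complement of `I` is a lower bound on `I`, and
-- negation turns it into an upper bound.
InP-dual⁺ : ∀ {f : Subset n → ℤ} {a} → f ⊥ ≡ 0ℤ → InP f a → InP (dual f) (neg a)
InP-dual⁺ {f = f} {a} f⊥≡0 (a≤f , total) = bound , (begin-equality
    sumOn ⊤ (neg a) ≡⟨ sumOn-neg ⊤ a ⟩
    - sumOn ⊤ a     ≡⟨ cong (λ s → - s) total ⟩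
    - f ⊤           ≡⟨ ℤP.+-identityˡ (- f ⊤) ⟨
    0ℤ - f ⊤        ≡⟨ cong (_- f ⊤) f⊥≡0 ⟨
    f ⊥ - f ⊤       ≡⟨ cong (λ I → f I - f ⊤) ∁-⊤ ⟨
    f (∁ ⊤) - f ⊤   ∎)
  where
  open ℤP.≤-Reasoning
  lemma : ∀ s t → - s ≡ t - (t + s)
  lemma = solve-∀
  bound : ∀ I → sumOn I (neg a) ℤ.≤ dual f I
  bound I = begin
    sumOn I (neg a)                              ≡⟨ sumOn-neg I a ⟩
    - sumOn I a                                  ≡⟨ lemma _ (sumOn (∁ I) a) ⟩
    sumOn (∁ I) a - (sumOn (∁ I) a + sumOn I a)  ≡⟨ cong (λ s → sumOn (∁ I) a - s) (trans (sumOn-∁ I a) total) ⟩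
    sumOn (∁ I) a - f ⊤                          ≤⟨ ℤP.+-monoˡ-≤ (- f ⊤) (a≤f (∁ I)) ⟩
    f (∁ I) - f ⊤                                ∎

InP-dual⁻ : ∀ {f : Subset n → ℤ} {a} → IsPolymatroidRank f → InP (dual f) a → InP f (neg a)
InP-dual⁻ {f = f} rank a∈P =
  InP-resp (dual-involutive {f = f} (proj₁ rank)) (InP-dual⁺ (proj₁ (dual-rank {f = f} rank)) a∈P)

-- Reversing the direction of an exchange is what turns exterior into interior activity.
neg-exch : ∀ (a : Vec ℤ n) {i j} → i ≢ j → neg (exch a j i) ≡ exch (neg a) i j
neg-exch a {i} {j} i≢j = trans
  (map-updateAt (updateAt a j _) i (lemma⁺ (lookup (updateAt a j (_- 1ℤ)) i)))
  (trans (cong (λ v → updateAt v i (_- 1ℤ)) (map-updateAt a j (lemma⁻ (lookup a j))))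
    (updateAt-commutes i j i≢j (neg a)))
  where
  lemma⁺ : ∀ x → - (x + 1ℤ) ≡ - x - 1ℤ
  lemma⁺ = solve-∀
  lemma⁻ : ∀ x → - (x - 1ℤ) ≡ - x + 1ℤ
  lemma⁻ = solve-∀

-- Comparing enumerations of the lattice points.

-- Allows the count over `points` to be made over another enumeration with a different order and
-- range.
length-≡ : ∀ {xs ys : List A} → Unique xs → Unique ys →
  (∀ {x} → x ∈ₗ xs → x ∈ₗ ys) → (∀ {x} → x ∈ₗ ys → x ∈ₗ xs) → length xs ≡ length ys
length-≡ !xs !ys xs⊆ys ys⊆xs = ↭-length (∼bag⇒↭ (unique∧set⇒bag !xs !ys (mk⇔ xs⊆ys ys⊆xs)))

concatMap≡cartesianProductWith : ∀ (f : A → B → C) xs ys →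
  concatMap (λ x → map (f x) ys) xs ≡ cartesianProductWith f xs ys
concatMap≡cartesianProductWith f []       ys = refl
concatMap≡cartesianProductWith f (x ∷ xs) ys = cong (map (f x) ys ++_) (concatMap≡cartesianProductWith f xs ys)

≤⇒∃+ : ∀ {x y} → x ℤ.≤ y → ∃ λ k → y ≡ x + ℤ.+ k
≤⇒∃+ {x} {y} x≤y = ∣ y - x ∣ , (begin
  y                 ≡⟨ lemma x y ⟩
  x + (y - x)       ≡⟨ cong (x +_) (ℤP.0≤i⇒+∣i∣≡i (ℤP.i≤j⇒0≤j-i x≤y)) ⟨
  x + ℤ.+ ∣ y - x ∣ ∎)
  where
  open ≡-Reasoning
  lemma : ∀ x y → y ≡ x + (y - x)
  lemma = solve-∀

x+y+z-x≡y+z : ∀ x y z → ((x + y) + z) - x ≡ y + z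
x+y+z-x≡y+z = solve-∀

∈-rangeℤ : ∀ {l h x} → l ℤ.≤ x → x ℤ.≤ h → x ∈ₗ rangeℤ l h
-- Writing x = l + p and h = l + p + q makes `h - l` the nonnegative p + q, which selects the first
-- clause of `rangeℤ`.
∈-rangeℤ {l} l≤x x≤h with p , refl ← ≤⇒∃+ l≤x with q , refl ← ≤⇒∃+ x≤h
  rewrite x+y+z-x≡y+z l (ℤ.+ p) (ℤ.+ q) = ∈-map⁺ (λ k → l + ℤ.+ k) (∈-upTo⁺ (s≤s (ℕP.m≤m+n p q)))

+-injectiveʳ : ∀ l {p q} → l + ℤ.+ p ≡ l + ℤ.+ q → p ≡ q
+-injectiveʳ l {p} {q} eq = ℤP.+-injective (∙-cancelˡ ℤP.+-0-abelianGroup l (ℤ.+ p) (ℤ.+ q) eq)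

rangeℤ-! : ∀ l h → Unique (rangeℤ l h)
rangeℤ-! l h with h - l
... | ℤ.+ m      = Unique.map⁺ (+-injectiveʳ l) (Unique.upTo⁺ (suc m))
... | ℤ.-[1+ _ ] = []

∈-box : ∀ (ls hs : Vec ℤ n) {a} → (∀ i → lookup ls i ℤ.≤ lookup a i) → (∀ i → lookup a i ℤ.≤ lookup hs i) → a ∈ₗ box ls hs
∈-box []       []       {[]}    _   _   = here refl
∈-box (l ∷ ls) (h ∷ hs) {x ∷ a} l≤a a≤h
  rewrite concatMap≡cartesianProductWith (Vec._∷_) (rangeℤ l h) (box ls hs)
  = ∈-cartesianProductWith⁺ _∷_ (∈-rangeℤ (l≤a Fin.zero) (a≤h Fin.zero)) (∈-box ls hs (l≤a ∘ Fin.suc) (a≤h ∘ Fin.suc))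

box-! : ∀ (ls hs : Vec ℤ n) → Unique (box ls hs)
box-! []       []       = All.[] ∷ []
box-! (l ∷ ls) (h ∷ hs)
  rewrite concatMap≡cartesianProductWith (Vec._∷_) (rangeℤ l h) (box ls hs)
  = Unique.cartesianProductWith⁺ _∷_ ∷-injective (rangeℤ-! l h) (box-! ls hs)

points-! : ∀ (f : Subset n → ℤ) → Unique (points f)
points-! f = Unique.filter⁺ (InP? f) (box-! (lowerB f) (upperB f))

∈-points⁺ : ∀ {f : Subset n → ℤ} {a} → InP f a → a ∈ₗ points f
∈-points⁺ {f = f} {a} a∈P@(a≤f , total) = ∈-filter⁺ (InP? f) (∈-box (lowerB f) (upperB f) lower upper) a∈P
  where
  open ℤP.≤-Reasoning
  lemma : ∀ s x → (s + x) - s ≡ x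
  lemma = solve-∀
  lower : ∀ i → lookup (lowerB f) i ℤ.≤ lookup a i
  lower i = begin
    lookup (lowerB f) i               ≡⟨ lookup∘tabulate (λ i → f ⊤ - f (⊤ minus i)) i ⟩
    f ⊤ - f (⊤ minus i)               ≤⟨ ℤP.+-monoʳ-≤ (f ⊤) (ℤP.neg-mono-≤ (a≤f (⊤ minus i))) ⟩
    f ⊤ - sumOn (⊤ minus i) a         ≡⟨ cong (_- sumOn (⊤ minus i) a) (trans (sumOn-minus a i) total) ⟨
    (sumOn (⊤ minus i) a + lookup a i) - sumOn (⊤ minus i) a ≡⟨ lemma (sumOn (⊤ minus i) a) (lookup a i) ⟩
    lookup a i                        ∎
  upper : ∀ i → lookup a i ℤ.≤ lookup (upperB f) i
  upper i = begin
    lookup a i          ≡⟨ sumOn-⁅⁆ a i ⟨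
    sumOn ⁅ i ⁆ a       ≤⟨ a≤f ⁅ i ⁆ ⟩
    f ⁅ i ⁆             ≡⟨ lookup∘tabulate (λ i → f ⁅ i ⁆) i ⟨
    lookup (upperB f) i ∎

∈-points⁻ : ∀ {f : Subset n → ℤ} {a} → a ∈ₗ points f → InP f a
∈-points⁻ {f = f} = proj₂ ∘ ∈-filter⁻ (InP? f) {xs = box (lowerB f) (upperB f)}

-- Enclosing a polymatroid in a cube.

norm : Vec ℤ n → ℕ
norm []      = 0
norm (x ∷ a) = ∣ x ∣ ℕ.+ norm a

∣lookup∣≤norm : ∀ (a : Vec ℤ n) i → ∣ lookup a i ∣ ≤ norm a
∣lookup∣≤norm (x ∷ a) Fin.zero    = ℕP.m≤m+n ∣ x ∣ (norm a)
∣lookup∣≤norm (x ∷ a) (Fin.suc i) = ℕP.≤-trans (∣lookup∣≤norm a i) (ℕP.m≤n+m (norm a) ∣ x ∣)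

-- One bound for all coordinates of all points, as the cube needs; the box behind `points` has
-- different sides in different coordinates. The default 0 covers the case of no points.
maxNorm : (Subset n → ℤ) → ℕ
maxNorm f = max 0 (map norm (points f))

∣lookup∣≤maxNorm : ∀ {f : Subset n → ℤ} {a} → InP f a → ∀ i → ∣ lookup a i ∣ ≤ maxNorm f
∣lookup∣≤maxNorm {f = f} {a} a∈P i = ℕP.≤-trans (∣lookup∣≤norm a i)
  (All.lookup (xs≤max 0 (map norm (points f))) (∈-map⁺ norm (∈-points⁺ a∈P)))

∣x∣≤B⇒-B≤x : ∀ {x B} → ∣ x ∣ ≤ B → - (ℤ.+ B) ℤ.≤ x
∣x∣≤B⇒-B≤x {ℤ.+ k}      {B} _         = ℤP.≤-trans (ℤP.neg-≤-pos {B} {0}) (ℤ.+≤+ z≤n)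
∣x∣≤B⇒-B≤x {ℤ.-[1+ k ]} {suc B} (s≤s k≤B) = ℤ.-≤- k≤B

∣x∣≤B⇒x≤B : ∀ {x B} → ∣ x ∣ ≤ B → x ℤ.≤ ℤ.+ B
∣x∣≤B⇒x≤B {ℤ.+ k}      k≤B = ℤ.+≤+ k≤B
∣x∣≤B⇒x≤B {ℤ.-[1+ k ]} _   = ℤ.-≤+

module _ (lo : ℤ) (M : ℕ) where
  open Grid lo M
  open ExchangeSet

  ∈-layers⁺ : ∀ {g : List (Vec ℤ n)} {m} k {a} → m < k → a ∈ₗ g → (a ∷ʳ coord m) ∈ₗ layers g k
  ∈-layers⁺ {g = g} {m} (suc k) (s≤s m≤k) a∈g with ℕP.m≤n⇒m<n∨m≡n m≤k
  ... | inj₁ m<k  = ∈-++⁺ˡ (∈-layers⁺ k m<k a∈g)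
  ... | inj₂ refl = ∈-++⁺ʳ (layers g k) (∈-map⁺ (_∷ʳ coord k) a∈g)

  ∈-grid⁺ : ∀ {a : Vec ℤ n} → (∀ i → ∃ λ k → k < M × lookup a i ≡ coord k) → a ∈ₗ grid n
  ∈-grid⁺ {zero}  {[]} _ = here refl
  ∈-grid⁺ {suc n} {a}  p with b , x , refl ← initLast a | k , k<M , eq ← p (fromℕ n)
    rewrite trans (sym (lookup-∷ʳ-fromℕ b)) eq
    = ∈-layers⁺ M k<M (∈-grid⁺ λ i → let m , m<M , eq′ = p (inject₁ i) in
        m , m<M , trans (sym (lookup-∷ʳ-inject₁ b i)) eq′)

  grid-! : ∀ n → Unique (grid n)
  grid-! zero    = All.[] ∷ []
  grid-! (suc n) = go M
    where
    go : ∀ k → Unique (layers (grid n) k)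
    go zero    = []
    go (suc k) = Unique.++⁺ (go k) (Unique.map⁺ (λ {a} {b} → ∷ʳ-injectiveˡ a b) (grid-! n)) disjoint
      where
      disjoint : ∀ {v} → ¬ (v ∈ₗ layers (grid n) k × v ∈ₗ map (_∷ʳ coord k) (grid n))
      disjoint (v∈ , v∈′) with m , m<k , a , _ , refl ← ∈-layers⁻ k v∈ | b , _ , eq ← ∈-map⁻ (_∷ʳ coord k) v∈′
        = ℤP.<-irrefl (∷ʳ-injectiveʳ a b eq) (coord-mono-< m<k)

  module _ {f : Subset n → ℤ} (rank : IsPolymatroidRank f) (bounded : ∀ {a} → InP f a → a ∈ₗ grid n) where

    polymatroid : ExchangeSet n
    polymatroid .Mem      = InP f
    polymatroid .mem?     = InP? f
    polymatroid .inGrid   = bounded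
    polymatroid .exchange = exchange-InP rank

    -- Both sides count the same points by the same exponent; only the enumerations differ.
    coeffI≡gridPoly : ∀ d → coeffI f d ≡ gridPoly polymatroid d
    coeffI≡gridPoly d = length-≡
      (Unique.filter⁺ deg? (points-! f))
      (Unique.filter⁺ (counted? polymatroid d) (grid-! n))
      (λ a∈ → let a∈P , eq = ∈-filter⁻ deg? a∈ in
        ∈-filter⁺ (counted? polymatroid d) (bounded (∈-points⁻ a∈P)) (∈-points⁻ a∈P , eq))
      (λ a∈ → let _ , a∈P , eq = ∈-filter⁻ (counted? polymatroid d) {xs = grid n} a∈ in
        ∈-filter⁺ deg? (∈-points⁺ a∈P) eq)
      where
      deg? : ∀ a → Dec (n ∸ #Int f a ≡ d)
      deg? a = (n ∸ #Int f a) ℕ.≟ d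

coeffI-mono : ∀ {f f′ : Subset n → ℤ} → IsPolymatroidRank f → IsPolymatroidRank f′ →
  (∀ a → InP f′ a → InP f a) → ∀ d → coeffI f′ d ≤ coeffI f d
coeffI-mono {n} {f} {f′} rank rank′ P′⊆P d = subst₂ _≤_
  (sym (coeffI≡gridPoly lo M rank′ (bounded ∘ P′⊆P _) d))
  (sym (coeffI≡gridPoly lo M rank bounded d))
  (gridPoly-mono (polymatroid lo M rank′ (bounded ∘ P′⊆P _)) (polymatroid lo M rank bounded) (P′⊆P _) d)
  where
  -- With B = `maxNorm f`, the cube has the 2B + 1 values from -B to B in each coordinate. It
  -- contains the smaller polymatroid by inclusion.
  lo : ℤ
  lo = - (ℤ.+ maxNorm f)
  M : ℕ
  M = suc (maxNorm f ℕ.+ maxNorm f)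
  open Grid lo M

  index<M : ∀ k → lo + ℤ.+ k ℤ.≤ ℤ.+ maxNorm f → k < M
  index<M k le = s≤s (ℤP.drop‿+≤+ (begin
    ℤ.+ k                               ≡⟨ lemma (ℤ.+ maxNorm f) (ℤ.+ k) ⟩
    ℤ.+ maxNorm f + (lo + ℤ.+ k)        ≤⟨ ℤP.+-monoʳ-≤ (ℤ.+ maxNorm f) le ⟩
    ℤ.+ maxNorm f + ℤ.+ maxNorm f       ∎))
    where
    open ℤP.≤-Reasoning
    lemma : ∀ b k → k ≡ b + (- b + k)
    lemma = solve-∀

  bounded : ∀ {a} → InP f a → a ∈ₗ grid n
  bounded {a} a∈P = ∈-grid⁺ lo M λ i →
    let ∣x∣≤B = ∣lookup∣≤maxNorm a∈P i
        k , eq = ≤⇒∃+ (∣x∣≤B⇒-B≤x ∣x∣≤B)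
    in k , index<M k (subst (ℤ._≤ ℤ.+ maxNorm f) eq (∣x∣≤B⇒x≤B ∣x∣≤B)) , eq

-- The exterior polynomial as an interior polynomial.

module _ {f : Subset n → ℤ} (rank : IsPolymatroidRank f) where

  -- Negation reverses each exchange but keeps the order of the indices, so the same indices are
  -- active on both sides.
  #Ext≡#Int-dual : ∀ a → #Ext f a ≡ #Int (dual f) (neg a)
  #Ext≡#Int-dual a = cong length (filter-≐ (ExtActive? f a) (IntActive? (dual f) (neg a))
    ((λ {i} → to i) , (λ {i} → from i)) (allFin n))
    where
    to : ∀ i → ExtActive f a i → IntActive (dual f) (neg a) i
    to i act j j<i p = act j j<i (subst (InP f) (neg-involutive (exch a j i))
      (InP-dual⁻ rank (subst (InP (dual f)) (sym (neg-exch a (FinP.<⇒≢ j<i ∘ sym))) p)))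

    from : ∀ i → IntActive (dual f) (neg a) i → ExtActive f a i
    from i act j j<i p = act j j<i
      (subst (InP (dual f)) (neg-exch a (FinP.<⇒≢ j<i ∘ sym)) (InP-dual⁺ (proj₁ rank) p))

  -- Negation is a bijection from P to -P that preserves the exponent.
  coeffX≡coeffI-dual : ∀ d → coeffX f d ≡ coeffI (dual f) d
  coeffX≡coeffI-dual d = trans (sym (length-map neg (filter ext? (points f))))
    (length-≡
      (Unique.map⁺ neg-injective (Unique.filter⁺ ext? (points-! f)))
      (Unique.filter⁺ int? (points-! (dual f)))
      to from)
    where
    ext? : ∀ a → Dec (n ∸ #Ext f a ≡ d)
    ext? a = (n ∸ #Ext f a) ℕ.≟ d

    int? : ∀ a → Dec (n ∸ #Int (dual f) a ≡ d)
    int? a = (n ∸ #Int (dual f) a) ℕ.≟ d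

    neg-injective : ∀ {a b : Vec ℤ n} → neg a ≡ neg b → a ≡ b
    neg-injective {a} {b} eq = trans (sym (neg-involutive a)) (trans (cong neg eq) (neg-involutive b))

    to : ∀ {b} → b ∈ₗ map neg (filter ext? (points f)) → b ∈ₗ filter int? (points (dual f))
    to b∈ with a , a∈ , refl ← ∈-map⁻ neg b∈ with a∈P , eq ← ∈-filter⁻ ext? a∈
      = ∈-filter⁺ int? (∈-points⁺ (InP-dual⁺ (proj₁ rank) (∈-points⁻ a∈P)))
          (trans (cong (n ∸_) (sym (#Ext≡#Int-dual a))) eq)

    from : ∀ {b} → b ∈ₗ filter int? (points (dual f)) → b ∈ₗ map neg (filter ext? (points f))
    from {b} b∈ with b∈P , eq ← ∈-filter⁻ int? b∈
      = subst (_∈ₗ map neg (filter ext? (points f))) (neg-involutive b)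
          (∈-map⁺ neg (∈-filter⁺ ext? (∈-points⁺ (InP-dual⁻ rank (∈-points⁻ b∈P)))
            (trans (cong (n ∸_) (trans (#Ext≡#Int-dual (neg b)) (cong (#Int (dual f)) (neg-involutive b)))) eq)))

coeffX-mono : ∀ {f f′ : Subset n → ℤ} → IsPolymatroidRank f → IsPolymatroidRank f′ →
  (∀ a → InP f′ a → InP f a) → ∀ d → coeffX f′ d ≤ coeffX f d
coeffX-mono {f = f} {f′} rank rank′ P′⊆P d = subst₂ _≤_
  (sym (coeffX≡coeffI-dual rank′ d)) (sym (coeffX≡coeffI-dual rank d))
  (coeffI-mono (dual-rank {f = f} rank) (dual-rank {f = f′} rank′) dual-⊆ d)
  where
  dual-⊆ : ∀ a → InP (dual f′) a → InP (dual f) a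
  dual-⊆ a p = subst (InP (dual f)) (neg-involutive a)
    (InP-dual⁺ (proj₁ rank) (P′⊆P (neg a) (InP-dual⁻ rank′ p)))

theorem4p2 : ∀ (n : ℕ) (f f′ : Subset n → ℤ) →
    IsPolymatroidRank f → IsPolymatroidRank f′ →
    (∀ (a : Vec ℤ n) → InP f′ a → InP f a) →
    (∀ (k : ℕ) → coeffI f′ k ≤ coeffI f k) × (∀ (k : ℕ) → coeffX f′ k ≤ coeffX f k)
theorem4p2 n f f′ rank rank′ P′⊆P = coeffI-mono rank rank′ P′⊆P , coeffX-mono rank rank′ P′⊆P
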